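{- Let $(p_1,p_2,p_3,p_4,p_5;\ a_1,a_2,a_3,a_4,a_5;\ \mu_1,\mu_2,\mu_3,\mu_4,\mu_5)$ be any one of the following 56 tuples of integers (each has $\gcd(p_1,\dots,p_5)=1$, and $p_i,a_i,\mu_i$ are related by $p_1-2<\mu_1<p_2-2<\mu_2<p_3-2<\mu_3<p_4-2<\mu_4<p_5-2<\mu_5$ and $a_k=\frac{\prod_{i=1}^{5}(\mu_i-p_k+2)}{p_k\prod_{i=1,i\ne k}^{5}(p_i-p_k)}$ for $k=1,\dots,5$): (1,3,5,12,20; 1302,254,185,70,132; 0,2,7,13,6478), (1,3,8,18,26; 1914,520,197,36,46; 0,4,14,21,6901), (1,3,9,23,35; 1596,444,91,112,22; 0,5,13,31,7105), (1,3,12,23,37; 580,155,77,12,8; 0,5,19,32,2551), (1,4,8,18,31; 3282,332,101,22,112; 1,5,14,20,9298), (1,4,13,18,33; 2355,230,82,47,85; 1,7,14,23,8006), (1,5,8,22,36; 754,20,47,24,24; 2,4,13,27,2638), (1,5,9,19,35; 1099,127,82,32,64; 1,5,13,23,5337), (1,5,9,22,36; 1688,84,30,57,16; 2,6,13,31,4219), (1,5,11,19,37; 1933,299,18,116,51; 1,8,11,29,7731), (1,6,8,10,19; 3112,157,106,136,100; 2,5,7,14,8168), (1,6,8,21,28; 1915,232,184,21,155; 1,5,14,20,9574), (1,6,9,16,24; 245,19,9,2,4; 2,6,13,19,574), (1,6,10,20,40; 2436,56,74,45,56; 3,6,14,28,6668), (1,6,12,20,32; 1638,83,98,68,56; 2,6,14,25,6478),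 (1,6,15,23,45; 4256,143,82,36,32; 3,10,19,37,8623), (1,7,9,17,20; 1071,33,31,18,42; 3,6,11,16,2735), (1,7,11,17,26; 344,113,39,56,68; 0,7,11,19,4299), (1,7,15,17,26; 2920,129,53,48,105; 3,9,14,19,8175), (1,8,10,18,23; 1064,107,56,99,140; 1,7,10,18,7496), (1,8,13,19,33; 3225,180,74,92,68; 3,9,14,26,9631), (1,8,13,22,31; 1228,102,22,51,96; 2,9,13,23,6446), (1,8,13,22,31; 1535,144,44,102,30; 2,9,14,27,6446), (1,8,13,22,31; 1842,198,88,51,24; 2,9,17,27,6446), (1,8,16,21,39; 3873,60,63,22,16; 5,11,18,34,6454), (1,15,20,24,36; 986,29,6,22,27; 6,16,19,28,3058), (2,4,8,21,35; 370,150,30,18,64; 1,5,12,22,4218), (2,5,9,20,34; 387,30,79,56,21; 2,4,12,28,3483), (2,5,10,14,22; 96,7,19,15,6; 2,4,10,18,768), (2,5,11,15,23; 908,590,134,51,80; 1,7,12,18,8853), (2,6,10,15,35; 1225,46,120,164,46; 3,5,10,28,8008), (2,6,10,15,35; 2058,184,80,41,39; 3,7,12,28,8008), (2,6,14,23,32; 413,20,28,70,18; 3,6,14,28,3540), (2,6,14,23,32; 590,50,7,22,45; 3,10,14,24,3540), (2,7,14,24,40; 564,60,147,131,54; 2,6,16,33,8930), (2,8,13,20,32; 1036,183,24,58,72; 3,10,14,24,7326), (2,9,14,20,50; 552,44,118,50,16; 3,8,16,42,4968), (2,10,14,19,22; 258,81,52,7,33; 2,10,16,18,2924), (2,10,16,21,26;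 198,28,10,3,6; 4,12,18,22,1064), (2,10,16,23,35; 654,258,63,57,62; 2,12,18,28,8393), (2,10,16,23,35; 1962,86,42,45,54; 6,12,18,28,8393), (2,10,20,23,34; 2575,133,47,30,52; 6,15,20,28,9888), (3,6,9,16,28; 387,254,70,92,128; 2,6,10,19,8386), (3,6,9,16,28; 516,381,140,23,104; 2,6,13,19,8386), (3,6,15,20,33; 532,82,86,33,112; 3,7,16,22,7753), (3,6,15,20,33; 798,164,43,24,98; 3,10,16,22,7753), (3,7,12,19,35; 450,148,20,51,45; 3,9,13,26,5185), (3,12,16,23,31; 411,51,13,3,46; 6,13,19,22,3563), (3,12,17,19,30; 410,215,60,74,50; 3,13,16,25,7750), (4,7,12,19,40; 78,51,40,21,31; 3,7,14,26,2810), (4,8,15,20,25; 230,170,189,101,38; 3,8,16,22,8098), (4,9,14,20,48; 179,70,12,81,9; 4,10,13,42,3582), (4,9,16,22,39; 129,136,22,18,134; 3,11,16,22,7742), (5,8,13,22,31; 379,85,55,30,80; 5,9,16,23,6446), (5,10,14,17,42; 385,156,66,163,27; 5,10,13,36,8328), (5,11,19,22,35; 344,249,24,75,21; 5,15,18,31,7313). Then for every positive integer $q$, the complete multipartite graph $K_{a_1\cdot p_1q,\,a_2\cdot p_2q,\,a_3\cdot p_3q,\,a_4\cdot p_4q,\,a_5\cdot p_5q}$ on $qn$ vertices, where $n=\sum_{i=1}^5 a_ip_i$, is distance integral.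
   Context: For a simple connected undirected graph $G$ with vertices $v_1,\dots,v_N$, the distance matrix $D(G)$ is the $N\times N$ matrix whose $(i,j)$-entry is the length $d_{ij}$ of a shortest path between $v_i$ and $v_j$ (so $d_{ii}=0$). $G$ is called distance integral if all eigenvalues of $D(G)$ are integers. For distinct positive integers $p_1<\dots<p_s$ and positive integers $a_1,\dots,a_s$, $K_{a_1\cdot p_1,\dots,a_s\cdot p_s}$ denotes the complete multipartite graph having exactly $a_i$ parts of size $p_i$ for each $i=1,\dots,s$ (two vertices are adjacent if and only if they lie in different parts). It has $\sum_i a_i$ parts and $\sum_i a_ip_i$ vertices. -}

module Defs where

open import Algebra.Apartness.Bundles using (HeytingCommutativeRing; HeytingField)
open import Algebra.Bundles using (CommutativeRing)
open import Data.Fin.Base using (Fin; zero; suc; splitAt; inject₁; punchIn)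
open import Data.Integer.Base as ℤ using (ℤ; +_; -[1+_])
open import Data.List.Base using (List; []; _∷_; length; concat; replicate)
open import Data.List.Relation.Unary.Unique.Propositional using (Unique)
open import Data.Nat.Base as ℕ using (ℕ; suc; _≤_)
open import Data.Nat.GCD using (gcd)
import Data.Nat.ListAction as List
open import Data.Product.Base using (Σ-syntax; ∃-syntax; _×_)
open import Data.Sum.Base using ([_,_]′)
open import Data.Vec.Base as Vec using (Vec; []; _∷_; toList; zipWith)
open import Data.Vec.Functional as Vector using (Vector)
open import Function.Base using (const; _∘_)
open import Level using (Level; 0ℓ; _⊔_) renaming (suc to lsuc)
open import Relation.Binary.Construct.Closure.ReflexiveTransitive using (Star; ε; _◅_)
open import Relation.Binary.Core using (Rel)
open import Relation.Binary.Definitions using (Symmetric; Irreflexive)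
open import Relation.Binary.PropositionalEquality using (_≡_; _≢_; refl; sym)

------------------------------------------------------------------------
-- Graphs and distance matrices

record Graph : Set₁ where
  field
    order      : ℕ
    Adj        : Rel (Fin order) 0ℓ
    Adj-sym    : Symmetric Adj
    Adj-irrefl : Irreflexive _≡_ Adj

  Vertex : Set
  Vertex = Fin order

  Walk : Rel Vertex 0ℓ
  Walk = Star Adj

  walkLength : ∀ {u v} → Walk u v → ℕ
  walkLength ε       = 0
  walkLength (_ ◅ w) = suc (walkLength w)

  vertices : ∀ {u v} → Walk u v → List Vertex
  vertices {u} ε       = u ∷ []
  vertices {u} (_ ◅ w) = u ∷ vertices w

  IsPath : ∀ {u v} → Walk u v → Set
  IsPath w = Unique (vertices w)

  IsDistance : Vertex → Vertex → ℕ → Set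
  IsDistance u v d =
    (∃[ w ] IsPath {u} {v} w × walkLength w ≡ d) ×
    (∀ (w : Walk u v) → IsPath w → d ≤ walkLength w)

Matrix : Set → ℕ → Set
Matrix A n = Fin n → Fin n → A

-- At most one matrix satisfies this, and one exists only when the graph
-- is connected.
IsDistanceMatrix : (G : Graph) → Matrix ℕ (Graph.order G) → Set
IsDistanceMatrix G D = ∀ u v → Graph.IsDistance G u v (D u v)

------------------------------------------------------------------------
-- Eigenvalues of an integer matrix

module _ {c ℓ₁ ℓ₂} (K : HeytingField c ℓ₁ ℓ₂) where

  open HeytingField K
  open HeytingCommutativeRing heytingCommutativeRing using (commutativeRing)
  open CommutativeRing commutativeRing using (+-rawMonoid)
  open import Algebra.Definitions.RawMonoid +-rawMonoid
    using (sum) renaming (_×_ to _·_)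

  fromℤ : ℤ → Carrier
  fromℤ (+ n)    = n · 1#
  fromℤ -[1+ n ] = - (suc n · 1#)

  CharacteristicZero : Set ℓ₂
  CharacteristicZero = ∀ n → fromℤ (+ suc n) # 0#

  IsEigenvalue : ∀ {n} → Matrix ℤ n → Carrier → Set (c ⊔ ℓ₁ ⊔ ℓ₂)
  IsEigenvalue {n} M x =
    Σ[ v ∈ Vector Carrier n ] (∃[ i ] v i # 0#) ×
      (∀ (i : Fin n) → sum (λ j → fromℤ (M i j) * v j) ≈ x * v i)

-- Eigenvalues are taken in an arbitrary field of characteristic zero.  The
-- real and the complex numbers are among these; a Heyting field, unlike a
-- field with decidable equality, covers them constructively as well.
AllEigenvaluesInteger : (c ℓ₁ ℓ₂ : Level) → ∀ {n} → Matrix ℤ n →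
                        Set (lsuc (c ⊔ ℓ₁ ⊔ ℓ₂))
AllEigenvaluesInteger c ℓ₁ ℓ₂ M =
  (K : HeytingField c ℓ₁ ℓ₂) → CharacteristicZero K →
  ∀ x → IsEigenvalue K M x → ∃[ z ] HeytingField._≈_ K x (fromℤ K z)

DistanceIntegral : (c ℓ₁ ℓ₂ : Level) → Graph → Set (lsuc (c ⊔ ℓ₁ ⊔ ℓ₂))
DistanceIntegral c ℓ₁ ℓ₂ G =
  ∃[ D ] IsDistanceMatrix G D ×
         AllEigenvaluesInteger c ℓ₁ ℓ₂ (λ u v → + D u v)

------------------------------------------------------------------------
-- Complete multipartite graphs

-- The vertices Fin (sum ss) are cut into consecutive blocks of the given
-- sizes; this is the index of the block containing a vertex.
part : (ss : List ℕ) → Fin (List.sum ss) → Fin (length ss)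
part (s ∷ ss) v = [ const zero , suc ∘ part ss ]′ (splitAt s v)

completeMultipartite : List ℕ → Graph
completeMultipartite ss = record
  { order      = List.sum ss
  ; Adj        = λ u v → part ss u ≢ part ss v
  ; Adj-sym    = λ u≁v eq → u≁v (sym eq)
  ; Adj-irrefl = λ { refl u≁u → u≁u refl }
  }

-- K_{a₁·p₁,…,aₛ·pₛ}
K[_·_] : ∀ {s} → Vec ℕ s → Vec ℕ s → Graph
K[ a · p ] = completeMultipartite (concat (toList (zipWith replicate a p)))

------------------------------------------------------------------------
-- The parameters

record Parameters : Set where
  constructor tuple
  field
    p a μ : Vec ℕ 5

∏ : ∀ {n} → Vector ℤ n → ℤ
∏ = Vector.foldr ℤ._*_ (+ 1)

module _ (t : Parameters) where

  open Parameters t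

  private
    pᶻ aᶻ μᶻ : Fin 5 → ℤ
    pᶻ i = + Vec.lookup p i
    aᶻ i = + Vec.lookup a i
    μᶻ i = + Vec.lookup μ i

  Coprime : Set
  Coprime = Vec.foldr (const ℕ) gcd 0 p ≡ 1

  Interlacing : Set
  Interlacing =
    (∀ (i : Fin 5) → pᶻ i ℤ.- + 2 ℤ.< μᶻ i) ×
    (∀ (i : Fin 4) → μᶻ (inject₁ i) ℤ.< pᶻ (suc i) ℤ.- + 2)

  -- The formula for a_k as a quotient, with its denominator cleared and
  -- separately required to be nonzero.  The indices i ≠ k are enumerated
  -- by punchIn k.
  MultiplicityFormula : Set
  MultiplicityFormula = ∀ (k : Fin 5) →
    let denominator = pᶻ k ℤ.* ∏ (λ j → pᶻ (punchIn k j) ℤ.- pᶻ k)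
    in denominator ≢ + 0 ×
       aᶻ k ℤ.* denominator ≡ ∏ (λ i → μᶻ i ℤ.- pᶻ k ℤ.+ + 2)

  numberOfVertices : ℕ
  numberOfVertices = Vec.sum (zipWith ℕ._*_ a p)

  scaledGraph : ℕ → Graph
  scaledGraph q = K[ a · Vec.map (ℕ._* q) p ]

table : List Parameters
table =
  tuple (1 ∷ 3 ∷ 5 ∷ 12 ∷ 20 ∷ []) (1302 ∷ 254 ∷ 185 ∷ 70 ∷ 132 ∷ []) (0 ∷ 2 ∷ 7 ∷ 13 ∷ 6478 ∷ []) ∷
  tuple (1 ∷ 3 ∷ 8 ∷ 18 ∷ 26 ∷ []) (1914 ∷ 520 ∷ 197 ∷ 36 ∷ 46 ∷ []) (0 ∷ 4 ∷ 14 ∷ 21 ∷ 6901 ∷ []) ∷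
  tuple (1 ∷ 3 ∷ 9 ∷ 23 ∷ 35 ∷ []) (1596 ∷ 444 ∷ 91 ∷ 112 ∷ 22 ∷ []) (0 ∷ 5 ∷ 13 ∷ 31 ∷ 7105 ∷ []) ∷
  tuple (1 ∷ 3 ∷ 12 ∷ 23 ∷ 37 ∷ []) (580 ∷ 155 ∷ 77 ∷ 12 ∷ 8 ∷ []) (0 ∷ 5 ∷ 19 ∷ 32 ∷ 2551 ∷ []) ∷
  tuple (1 ∷ 4 ∷ 8 ∷ 18 ∷ 31 ∷ []) (3282 ∷ 332 ∷ 101 ∷ 22 ∷ 112 ∷ []) (1 ∷ 5 ∷ 14 ∷ 20 ∷ 9298 ∷ []) ∷
  tuple (1 ∷ 4 ∷ 13 ∷ 18 ∷ 33 ∷ []) (2355 ∷ 230 ∷ 82 ∷ 47 ∷ 85 ∷ []) (1 ∷ 7 ∷ 14 ∷ 23 ∷ 8006 ∷ []) ∷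
  tuple (1 ∷ 5 ∷ 8 ∷ 22 ∷ 36 ∷ []) (754 ∷ 20 ∷ 47 ∷ 24 ∷ 24 ∷ []) (2 ∷ 4 ∷ 13 ∷ 27 ∷ 2638 ∷ []) ∷
  tuple (1 ∷ 5 ∷ 9 ∷ 19 ∷ 35 ∷ []) (1099 ∷ 127 ∷ 82 ∷ 32 ∷ 64 ∷ []) (1 ∷ 5 ∷ 13 ∷ 23 ∷ 5337 ∷ []) ∷
  tuple (1 ∷ 5 ∷ 9 ∷ 22 ∷ 36 ∷ []) (1688 ∷ 84 ∷ 30 ∷ 57 ∷ 16 ∷ []) (2 ∷ 6 ∷ 13 ∷ 31 ∷ 4219 ∷ []) ∷
  tuple (1 ∷ 5 ∷ 11 ∷ 19 ∷ 37 ∷ []) (1933 ∷ 299 ∷ 18 ∷ 116 ∷ 51 ∷ []) (1 ∷ 8 ∷ 11 ∷ 29 ∷ 7731 ∷ []) ∷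
  tuple (1 ∷ 6 ∷ 8 ∷ 10 ∷ 19 ∷ []) (3112 ∷ 157 ∷ 106 ∷ 136 ∷ 100 ∷ []) (2 ∷ 5 ∷ 7 ∷ 14 ∷ 8168 ∷ []) ∷
  tuple (1 ∷ 6 ∷ 8 ∷ 21 ∷ 28 ∷ []) (1915 ∷ 232 ∷ 184 ∷ 21 ∷ 155 ∷ []) (1 ∷ 5 ∷ 14 ∷ 20 ∷ 9574 ∷ []) ∷
  tuple (1 ∷ 6 ∷ 9 ∷ 16 ∷ 24 ∷ []) (245 ∷ 19 ∷ 9 ∷ 2 ∷ 4 ∷ []) (2 ∷ 6 ∷ 13 ∷ 19 ∷ 574 ∷ []) ∷
  tuple (1 ∷ 6 ∷ 10 ∷ 20 ∷ 40 ∷ []) (2436 ∷ 56 ∷ 74 ∷ 45 ∷ 56 ∷ []) (3 ∷ 6 ∷ 14 ∷ 28 ∷ 6668 ∷ []) ∷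
  tuple (1 ∷ 6 ∷ 12 ∷ 20 ∷ 32 ∷ []) (1638 ∷ 83 ∷ 98 ∷ 68 ∷ 56 ∷ []) (2 ∷ 6 ∷ 14 ∷ 25 ∷ 6478 ∷ []) ∷
  tuple (1 ∷ 6 ∷ 15 ∷ 23 ∷ 45 ∷ []) (4256 ∷ 143 ∷ 82 ∷ 36 ∷ 32 ∷ []) (3 ∷ 10 ∷ 19 ∷ 37 ∷ 8623 ∷ []) ∷
  tuple (1 ∷ 7 ∷ 9 ∷ 17 ∷ 20 ∷ []) (1071 ∷ 33 ∷ 31 ∷ 18 ∷ 42 ∷ []) (3 ∷ 6 ∷ 11 ∷ 16 ∷ 2735 ∷ []) ∷
  tuple (1 ∷ 7 ∷ 11 ∷ 17 ∷ 26 ∷ []) (344 ∷ 113 ∷ 39 ∷ 56 ∷ 68 ∷ []) (0 ∷ 7 ∷ 11 ∷ 19 ∷ 4299 ∷ []) ∷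
  tuple (1 ∷ 7 ∷ 15 ∷ 17 ∷ 26 ∷ []) (2920 ∷ 129 ∷ 53 ∷ 48 ∷ 105 ∷ []) (3 ∷ 9 ∷ 14 ∷ 19 ∷ 8175 ∷ []) ∷
  tuple (1 ∷ 8 ∷ 10 ∷ 18 ∷ 23 ∷ []) (1064 ∷ 107 ∷ 56 ∷ 99 ∷ 140 ∷ []) (1 ∷ 7 ∷ 10 ∷ 18 ∷ 7496 ∷ []) ∷
  tuple (1 ∷ 8 ∷ 13 ∷ 19 ∷ 33 ∷ []) (3225 ∷ 180 ∷ 74 ∷ 92 ∷ 68 ∷ []) (3 ∷ 9 ∷ 14 ∷ 26 ∷ 9631 ∷ []) ∷
  tuple (1 ∷ 8 ∷ 13 ∷ 22 ∷ 31 ∷ []) (1228 ∷ 102 ∷ 22 ∷ 51 ∷ 96 ∷ []) (2 ∷ 9 ∷ 13 ∷ 23 ∷ 6446 ∷ []) ∷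
  tuple (1 ∷ 8 ∷ 13 ∷ 22 ∷ 31 ∷ []) (1535 ∷ 144 ∷ 44 ∷ 102 ∷ 30 ∷ []) (2 ∷ 9 ∷ 14 ∷ 27 ∷ 6446 ∷ []) ∷
  tuple (1 ∷ 8 ∷ 13 ∷ 22 ∷ 31 ∷ []) (1842 ∷ 198 ∷ 88 ∷ 51 ∷ 24 ∷ []) (2 ∷ 9 ∷ 17 ∷ 27 ∷ 6446 ∷ []) ∷
  tuple (1 ∷ 8 ∷ 16 ∷ 21 ∷ 39 ∷ []) (3873 ∷ 60 ∷ 63 ∷ 22 ∷ 16 ∷ []) (5 ∷ 11 ∷ 18 ∷ 34 ∷ 6454 ∷ []) ∷
  tuple (1 ∷ 15 ∷ 20 ∷ 24 ∷ 36 ∷ []) (986 ∷ 29 ∷ 6 ∷ 22 ∷ 27 ∷ []) (6 ∷ 16 ∷ 19 ∷ 28 ∷ 3058 ∷ []) ∷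
  tuple (2 ∷ 4 ∷ 8 ∷ 21 ∷ 35 ∷ []) (370 ∷ 150 ∷ 30 ∷ 18 ∷ 64 ∷ []) (1 ∷ 5 ∷ 12 ∷ 22 ∷ 4218 ∷ []) ∷
  tuple (2 ∷ 5 ∷ 9 ∷ 20 ∷ 34 ∷ []) (387 ∷ 30 ∷ 79 ∷ 56 ∷ 21 ∷ []) (2 ∷ 4 ∷ 12 ∷ 28 ∷ 3483 ∷ []) ∷
  tuple (2 ∷ 5 ∷ 10 ∷ 14 ∷ 22 ∷ []) (96 ∷ 7 ∷ 19 ∷ 15 ∷ 6 ∷ []) (2 ∷ 4 ∷ 10 ∷ 18 ∷ 768 ∷ []) ∷
  tuple (2 ∷ 5 ∷ 11 ∷ 15 ∷ 23 ∷ []) (908 ∷ 590 ∷ 134 ∷ 51 ∷ 80 ∷ []) (1 ∷ 7 ∷ 12 ∷ 18 ∷ 8853 ∷ []) ∷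
  tuple (2 ∷ 6 ∷ 10 ∷ 15 ∷ 35 ∷ []) (1225 ∷ 46 ∷ 120 ∷ 164 ∷ 46 ∷ []) (3 ∷ 5 ∷ 10 ∷ 28 ∷ 8008 ∷ []) ∷
  tuple (2 ∷ 6 ∷ 10 ∷ 15 ∷ 35 ∷ []) (2058 ∷ 184 ∷ 80 ∷ 41 ∷ 39 ∷ []) (3 ∷ 7 ∷ 12 ∷ 28 ∷ 8008 ∷ []) ∷
  tuple (2 ∷ 6 ∷ 14 ∷ 23 ∷ 32 ∷ []) (413 ∷ 20 ∷ 28 ∷ 70 ∷ 18 ∷ []) (3 ∷ 6 ∷ 14 ∷ 28 ∷ 3540 ∷ []) ∷
  tuple (2 ∷ 6 ∷ 14 ∷ 23 ∷ 32 ∷ []) (590 ∷ 50 ∷ 7 ∷ 22 ∷ 45 ∷ []) (3 ∷ 10 ∷ 14 ∷ 24 ∷ 3540 ∷ []) ∷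
  tuple (2 ∷ 7 ∷ 14 ∷ 24 ∷ 40 ∷ []) (564 ∷ 60 ∷ 147 ∷ 131 ∷ 54 ∷ []) (2 ∷ 6 ∷ 16 ∷ 33 ∷ 8930 ∷ []) ∷
  tuple (2 ∷ 8 ∷ 13 ∷ 20 ∷ 32 ∷ []) (1036 ∷ 183 ∷ 24 ∷ 58 ∷ 72 ∷ []) (3 ∷ 10 ∷ 14 ∷ 24 ∷ 7326 ∷ []) ∷
  tuple (2 ∷ 9 ∷ 14 ∷ 20 ∷ 50 ∷ []) (552 ∷ 44 ∷ 118 ∷ 50 ∷ 16 ∷ []) (3 ∷ 8 ∷ 16 ∷ 42 ∷ 4968 ∷ []) ∷
  tuple (2 ∷ 10 ∷ 14 ∷ 19 ∷ 22 ∷ []) (258 ∷ 81 ∷ 52 ∷ 7 ∷ 33 ∷ []) (2 ∷ 10 ∷ 16 ∷ 18 ∷ 2924 ∷ []) ∷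
  tuple (2 ∷ 10 ∷ 16 ∷ 21 ∷ 26 ∷ []) (198 ∷ 28 ∷ 10 ∷ 3 ∷ 6 ∷ []) (4 ∷ 12 ∷ 18 ∷ 22 ∷ 1064 ∷ []) ∷
  tuple (2 ∷ 10 ∷ 16 ∷ 23 ∷ 35 ∷ []) (654 ∷ 258 ∷ 63 ∷ 57 ∷ 62 ∷ []) (2 ∷ 12 ∷ 18 ∷ 28 ∷ 8393 ∷ []) ∷
  tuple (2 ∷ 10 ∷ 16 ∷ 23 ∷ 35 ∷ []) (1962 ∷ 86 ∷ 42 ∷ 45 ∷ 54 ∷ []) (6 ∷ 12 ∷ 18 ∷ 28 ∷ 8393 ∷ []) ∷
  tuple (2 ∷ 10 ∷ 20 ∷ 23 ∷ 34 ∷ []) (2575 ∷ 133 ∷ 47 ∷ 30 ∷ 52 ∷ []) (6 ∷ 15 ∷ 20 ∷ 28 ∷ 9888 ∷ []) ∷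
  tuple (3 ∷ 6 ∷ 9 ∷ 16 ∷ 28 ∷ []) (387 ∷ 254 ∷ 70 ∷ 92 ∷ 128 ∷ []) (2 ∷ 6 ∷ 10 ∷ 19 ∷ 8386 ∷ []) ∷
  tuple (3 ∷ 6 ∷ 9 ∷ 16 ∷ 28 ∷ []) (516 ∷ 381 ∷ 140 ∷ 23 ∷ 104 ∷ []) (2 ∷ 6 ∷ 13 ∷ 19 ∷ 8386 ∷ []) ∷
  tuple (3 ∷ 6 ∷ 15 ∷ 20 ∷ 33 ∷ []) (532 ∷ 82 ∷ 86 ∷ 33 ∷ 112 ∷ []) (3 ∷ 7 ∷ 16 ∷ 22 ∷ 7753 ∷ []) ∷
  tuple (3 ∷ 6 ∷ 15 ∷ 20 ∷ 33 ∷ []) (798 ∷ 164 ∷ 43 ∷ 24 ∷ 98 ∷ []) (3 ∷ 10 ∷ 16 ∷ 22 ∷ 7753 ∷ []) ∷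
  tuple (3 ∷ 7 ∷ 12 ∷ 19 ∷ 35 ∷ []) (450 ∷ 148 ∷ 20 ∷ 51 ∷ 45 ∷ []) (3 ∷ 9 ∷ 13 ∷ 26 ∷ 5185 ∷ []) ∷
  tuple (3 ∷ 12 ∷ 16 ∷ 23 ∷ 31 ∷ []) (411 ∷ 51 ∷ 13 ∷ 3 ∷ 46 ∷ []) (6 ∷ 13 ∷ 19 ∷ 22 ∷ 3563 ∷ []) ∷
  tuple (3 ∷ 12 ∷ 17 ∷ 19 ∷ 30 ∷ []) (410 ∷ 215 ∷ 60 ∷ 74 ∷ 50 ∷ []) (3 ∷ 13 ∷ 16 ∷ 25 ∷ 7750 ∷ []) ∷
  tuple (4 ∷ 7 ∷ 12 ∷ 19 ∷ 40 ∷ []) (78 ∷ 51 ∷ 40 ∷ 21 ∷ 31 ∷ []) (3 ∷ 7 ∷ 14 ∷ 26 ∷ 2810 ∷ []) ∷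
  tuple (4 ∷ 8 ∷ 15 ∷ 20 ∷ 25 ∷ []) (230 ∷ 170 ∷ 189 ∷ 101 ∷ 38 ∷ []) (3 ∷ 8 ∷ 16 ∷ 22 ∷ 8098 ∷ []) ∷
  tuple (4 ∷ 9 ∷ 14 ∷ 20 ∷ 48 ∷ []) (179 ∷ 70 ∷ 12 ∷ 81 ∷ 9 ∷ []) (4 ∷ 10 ∷ 13 ∷ 42 ∷ 3582 ∷ []) ∷
  tuple (4 ∷ 9 ∷ 16 ∷ 22 ∷ 39 ∷ []) (129 ∷ 136 ∷ 22 ∷ 18 ∷ 134 ∷ []) (3 ∷ 11 ∷ 16 ∷ 22 ∷ 7742 ∷ []) ∷
  tuple (5 ∷ 8 ∷ 13 ∷ 22 ∷ 31 ∷ []) (379 ∷ 85 ∷ 55 ∷ 30 ∷ 80 ∷ []) (5 ∷ 9 ∷ 16 ∷ 23 ∷ 6446 ∷ []) ∷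
  tuple (5 ∷ 10 ∷ 14 ∷ 17 ∷ 42 ∷ []) (385 ∷ 156 ∷ 66 ∷ 163 ∷ 27 ∷ []) (5 ∷ 10 ∷ 13 ∷ 36 ∷ 8328 ∷ []) ∷
  tuple (5 ∷ 11 ∷ 19 ∷ 22 ∷ 35 ∷ []) (344 ∷ 249 ∷ 24 ∷ 75 ∷ 21 ∷ []) (5 ∷ 15 ∷ 18 ∷ 31 ∷ 7313 ∷ []) ∷
  []

{-# OPTIONS --safe #-}

-- Put y = x + 2.  The distance matrix of a complete multipartite graph is
-- J + B - 2I, where B is the 0/1 matrix of "same part", so an eigenvector v
-- satisfies y v_i = S + T_P for i in the part P, with S the sum of all
-- entries and T_P the sum over P.  Summing over a part of size q p gives
-- (y - q p) T_P = q p S.  With y = - u q this reads (u + p) T_P = p (- S), and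
-- summing over all parts yields
--   (∏ (u + p_k) + ∑ a_k p_k ∏_{j≠k} (u + p_j)) S = 0.
-- The multiplicity formula says that the first factor is ∏ (u + μ_k + 2); for
-- the given tuples this is verified by comparing coefficients.  Hence
-- u ∏ (u + p_k) ∏ (u + μ_k + 2) annihilates every v_i.  The negation in
-- y = - u q is what makes all these polynomials have natural coefficients.
-- In a Heyting field the vanishing of a product of factors u + n with
-- distinct n singles out a vanishing factor, by cotransitivity.
module Submission where

open import Defs
open import Algebra.Apartness.Bundles using (HeytingCommutativeRing; HeytingField)
open import Algebra.Bundles using (CommutativeRing)
open import Data.Bool.Base using (if_then_else_)
open import Data.Fin.Base using (Fin; zero; suc; _↑ˡ_; _↑ʳ_)
import Data.Fin.Properties as Fin
open import Data.Integer.Base using (+_; -[1+_])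
import Data.Integer.Properties as ℤ
open import Data.List.Base as List using (List; []; _∷_; _++_)
open import Data.List.Membership.Propositional using (_∈_)
open import Data.List.Properties using (≡-dec)
open import Data.List.Relation.Unary.All as All using ([]; _∷_)
open import Data.List.Relation.Unary.AllPairs using ([]; _∷_)
open import Data.Nat.Base as ℕ using (ℕ; zero; suc; _<_; _*_; z≤n; s≤s)
open import Data.Nat.ListAction using () renaming (sum to listSum)
import Data.Nat.Properties as ℕ
open import Data.Nat.Solver using (module +-*-Solver)
open import Data.Product.Base as Product using (∃-syntax; _×_; _,_)
open import Data.Sum.Base using (_⊎_; inj₁; inj₂; [_,_]′)
open import Data.Vec.Base as Vec using (Vec; []; _∷_)
open import Data.Vec.Relation.Unary.All using ([]; _∷_)
open import Data.Vec.Relation.Unary.AllPairs using ([]; _∷_; allPairs?)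
open import Data.Vec.Relation.Unary.Unique.Propositional using (Unique)
open import Function.Base using (const; _∘_)
open import Level using (Level)
open import Relation.Binary.Construct.Closure.ReflexiveTransitive using (ε; _◅_)
open import Relation.Binary.Definitions using (tri<; tri≈; tri>)
open import Relation.Binary.PropositionalEquality as ≡ using (_≡_; _≢_; refl)
open import Relation.Nullary.Decidable using (Dec; yes; no; does; ¬?; _×-dec_; toWitness)
open import Relation.Nullary.Negation using (contradiction)

-- Distances in complete multipartite graphs

distance : ∀ ss → Matrix ℕ (listSum ss)
distance ss u v =
  if does (part ss v Fin.≟ part ss u)
  then (if does (u Fin.≟ v) then 0 else 2)
  else 1

-- A walk of length 0 joins equal vertices and one of length 1 joins different parts, which gives
-- the lower bounds. `other` supplies the midpoint of a path between two distinct vertices of one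
-- part.
distance-isDistanceMatrix : ∀ ss → (∀ u → ∃[ w ] part ss w ≢ part ss u) →
                            IsDistanceMatrix (completeMultipartite ss) (distance ss)
distance-isDistanceMatrix ss other u v
  with part ss v Fin.≟ part ss u | u Fin.≟ v
... | yes _  | yes refl = (ε , [] ∷ [] , refl) , λ _ _ → z≤n
... | no v≁u | _ =
  ((v≁u ∘ ≡.sym) ◅ ε , ((λ { refl → v≁u refl }) ∷ []) ∷ [] ∷ [] , refl) ,
  λ { ε _ → contradiction refl v≁u ; (_ ◅ _) _ → s≤s z≤n }
... | yes v~u | no u≢v with w , w≁u ← other u =
  ( (w≁u ∘ ≡.sym) ◅ (λ w~v → w≁u (≡.trans w~v v~u)) ◅ ε
  , ((λ { refl → w≁u refl }) ∷ u≢v ∷ []) ∷ ((λ { refl → w≁u v~u }) ∷ []) ∷ [] ∷ []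
  , refl ) ,
  λ { ε _ → contradiction refl u≢v
    ; (u≁v ◅ ε) _ → contradiction (≡.sym v~u) u≁v
    ; (_ ◅ _ ◅ _) _ → s≤s (s≤s z≤n) }

part-↑ˡ : ∀ s ss i → part (s ∷ ss) (i ↑ˡ listSum ss) ≡ zero
part-↑ˡ s ss i = ≡.cong [ const zero , suc ∘ part ss ]′ (Fin.splitAt-↑ˡ s i (listSum ss))

part-↑ʳ : ∀ s ss v → part (s ∷ ss) (s ↑ʳ v) ≡ suc (part ss v)
part-↑ʳ s ss v = ≡.cong [ const zero , suc ∘ part ss ]′ (Fin.splitAt-↑ʳ s (listSum ss) v)

-- The first vertex lies in part `zero` and so avoids every later part; for part `zero` itself the
-- first vertex of the second block serves.
two-parts : ∀ s s′ ss → let ss⁺ = suc s ∷ suc s′ ∷ ss in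
            ∀ u → ∃[ w ] part ss⁺ w ≢ part ss⁺ u
two-parts s s′ ss u with part (suc s ∷ suc s′ ∷ ss) u
... | suc _ = zero , λ ()
... | zero  = suc s ↑ʳ zero ,
  λ w~u → Fin.0≢1+n (≡.trans (≡.sym w~u) (part-↑ʳ (suc s) (suc s′ ∷ ss) zero))

-- Block sizes of the scaled graph

parts : ∀ {k} → Vec ℕ k → Vec ℕ k → List ℕ
parts a p = List.concat (Vec.toList (Vec.zipWith List.replicate a p))

-- A first multiplicity of at least 2 and a positive first size give two nonempty leading blocks.
parts-other : ∀ {k} q (a p : Vec ℕ (suc k)) → 1 < Vec.head a → 0 < Vec.head p →
              let ss = parts a (Vec.map (_* suc q) p) in
              ∀ u → ∃[ w ] part ss w ≢ part ss u
parts-other q (suc (suc n) ∷ a) (suc x ∷ p) _ _ =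
  two-parts _ _ (parts (n ∷ a) (Vec.map (_* suc q) (suc x ∷ p)))
parts-other q (suc zero    ∷ a) _           (s≤s ()) _

-- One part is peeled off at a time: the first multiplicity drops to zero, then the next size is
-- reached. Later inductions over `parts` follow the same pattern.
sum-parts : ∀ {k} q (a p : Vec ℕ k) →
            listSum (parts a (Vec.map (_* q) p)) ≡ q * Vec.sum (Vec.zipWith _*_ a p)
sum-parts q []          []      = ≡.sym (ℕ.*-zeroʳ q)
sum-parts q (zero  ∷ a) (x ∷ p) = sum-parts q a p
sum-parts q (suc n ∷ a) (x ∷ p) = begin
  x * q ℕ.+ listSum (parts (n ∷ a) (Vec.map (_* q) (x ∷ p)))
    ≡⟨ ≡.cong (x * q ℕ.+_) (sum-parts q (n ∷ a) (x ∷ p)) ⟩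
  x * q ℕ.+ q * (n * x ℕ.+ Vec.sum (Vec.zipWith _*_ a p))
    ≡⟨ solve 4 (λ x q m r → x :* q :+ q :* (m :+ r) := q :* (x :+ m :+ r)) refl x q (n * x) _ ⟩
  q * (x ℕ.+ n * x ℕ.+ Vec.sum (Vec.zipWith _*_ a p)) ∎
  where
  open ≡.≡-Reasoning
  open +-*-Solver

-- Polynomials with natural coefficients, constant coefficient first

Poly : Set
Poly = List ℕ

infixl 6 _⊞_

_⊞_ : Poly → Poly → Poly
[]      ⊞ g       = g
(m ∷ f) ⊞ []      = m ∷ f
(m ∷ f) ⊞ (n ∷ g) = (m ℕ.+ n) ∷ (f ⊞ g)

scale : ℕ → Poly → Poly
scale n = List.map (n *_)

X+_⊠_ : ℕ → Poly → Poly
X+ n ⊠ f = (0 ∷ f) ⊞ scale n f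

∏X+ : ∀ {k} → Vec ℕ k → Poly
∏X+ []       = 1 ∷ []
∏X+ (n ∷ ns) = X+ n ⊠ ∏X+ ns

-- The polynomial ∑ a_k p_k ∏_{j≠k} (X + p_j).
residual : ∀ {k} → Vec ℕ k → Vec ℕ k → Poly
residual []      []      = []
residual (n ∷ a) (x ∷ p) = scale (n * x) (∏X+ p) ⊞ (X+ x ⊠ residual a p)

module RingIdentities {c ℓ} (R : CommutativeRing c ℓ) where

  open CommutativeRing R hiding (zero) renaming (_*_ to infixl 7 _∙_; refl to ≈-refl)
  open import Algebra.Properties.Semiring.Mult semiring
    using (×-homo-+; ×1-homo-*) renaming (_×_ to _·_)
  open import Algebra.Properties.Semiring.Sum semiring
  open import Relation.Binary.Reasoning.Setoid setoid
  open import Algebra.Solver.Ring.NaturalCoefficients.Default commutativeSemiring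
    using (solve; _:=_; _:+_; _:*_; con)

  ι : ℕ → Carrier
  ι n = n · 1#

  ι-+ : ∀ m n → ι (m ℕ.+ n) ≈ ι m + ι n
  ι-+ = ×-homo-+ 1#

  -- Sums over the vertices

  -- Going through `does` makes `δ (suc i) (suc j)` compute to `δ i j`.
  δ : ∀ {n} → Fin n → Fin n → Carrier
  δ i j = if does (i Fin.≟ j) then 1# else 0#

  δ-sym : ∀ {n} (i j : Fin n) → δ i j ≡ δ j i
  δ-sym zero    zero    = refl
  δ-sym zero    (suc j) = refl
  δ-sym (suc i) zero    = refl
  δ-sym (suc i) (suc j) = δ-sym i j

  ∑-zero : ∀ {n} (f : Fin n → Carrier) → ∑[ j < n ] (0# ∙ f j) ≈ 0#
  ∑-zero {n} f = trans (sym (*-distribˡ-sum {n} 0# f)) (zeroˡ (sum f))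

  ∑-δ : ∀ {n} (i : Fin n) (f : Fin n → Carrier) → ∑[ j < n ] (δ i j ∙ f j) ≈ f i
  ∑-δ {suc n} zero f = begin
    1# ∙ f zero + ∑[ j < n ] (0# ∙ f (suc j)) ≈⟨ +-cong (*-identityˡ (f zero)) (∑-zero {n} (f ∘ suc)) ⟩
    f zero + 0#                               ≈⟨ +-identityʳ (f zero) ⟩
    f zero                                    ∎
  ∑-δ {suc n} (suc i) f = begin
    0# ∙ f zero + ∑[ j < n ] (δ i j ∙ f (suc j)) ≈⟨ +-cong (zeroˡ (f zero)) (∑-δ {n} i (f ∘ suc)) ⟩
    0# + f (suc i)                               ≈⟨ +-identityˡ (f (suc i)) ⟩
    f (suc i)                                    ∎

  ∑-splitAt : ∀ m n (f : Fin (m ℕ.+ n) → Carrier) →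
              sum f ≈ ∑[ i < m ] f (i ↑ˡ n) + ∑[ j < n ] f (m ↑ʳ j)
  ∑-splitAt zero    n f = sym (+-identityˡ (sum f))
  ∑-splitAt (suc m) n f = trans (+-congˡ (∑-splitAt m n (f ∘ suc))) (sym (+-assoc (f zero) _ _))

  -- The first block is exactly part `zero`, so it contributes `g zero` once per vertex; the other
  -- blocks follow by induction.
  ∑-part : ∀ ss (g : Fin (List.length ss) → Carrier) →
           ∑[ v < listSum ss ] g (part ss v) ≈
           ∑[ d < List.length ss ] (ι (List.lookup ss d) ∙ g d)
  ∑-part []       g = ≈-refl
  ∑-part (s ∷ ss) g = begin
    ∑[ v < s ℕ.+ listSum ss ] g (part (s ∷ ss) v)
      ≈⟨ ∑-splitAt s (listSum ss) (g ∘ part (s ∷ ss)) ⟩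
    ∑[ i < s ] g (part (s ∷ ss) (i ↑ˡ listSum ss)) +
    ∑[ v < listSum ss ] g (part (s ∷ ss) (s ↑ʳ v))
      ≡⟨ ≡.cong₂ _+_ (sum-cong-≗ {s} (≡.cong g ∘ part-↑ˡ s ss)) (sum-cong-≗ {listSum ss} (≡.cong g ∘ part-↑ʳ s ss)) ⟩
    ∑[ i < s ] g zero + ∑[ v < listSum ss ] g (suc (part ss v))
      ≈⟨ +-cong (first s) (∑-part ss (g ∘ suc)) ⟩
    ι s ∙ g zero + ∑[ d < List.length ss ] (ι (List.lookup ss d) ∙ g (suc d)) ∎
    where
    first : ∀ s → ∑[ i < s ] g zero ≈ ι s ∙ g zero
    first zero    = sym (zeroˡ (g zero))
    first (suc s) = begin
      g zero + ∑[ i < s ] g zero ≈⟨ +-cong (sym (*-identityˡ (g zero))) (first s) ⟩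
      1# ∙ g zero + ι s ∙ g zero ≈⟨ distribʳ (g zero) 1# (ι s) ⟨
      ι (suc s) ∙ g zero         ∎

  -- The distance matrix acting on a vector

  module _ (ss : List ℕ) (v : Fin (listSum ss) → Carrier) where

    -- Written as a sum over all vertices with an indicator weight, so that linearity and exchange
    -- of summation apply directly.
    partSum : Fin (List.length ss) → Carrier
    partSum d = ∑[ j < listSum ss ] (δ (part ss j) d ∙ v j)

    ∑-partSum : sum partSum ≈ sum v
    ∑-partSum = begin
      ∑[ d < List.length ss ] ∑[ j < listSum ss ] (δ (part ss j) d ∙ v j)
        ≈⟨ ∑-comm {List.length ss} {listSum ss} (λ d j → δ (part ss j) d ∙ v j) ⟩
      ∑[ j < listSum ss ] ∑[ d < List.length ss ] (δ (part ss j) d ∙ v j)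
        -- Each vertex lies in exactly one part.
        ≈⟨ sum-cong-≋ {listSum ss} (λ j → ∑-δ (part ss j) (const (v j))) ⟩
      sum v ∎

    -- This is D + 2I = J + B entry by entry, arranged without subtraction.
    distance-entry : ∀ i j → ι (distance ss i j) + ι 2 ∙ δ i j ≈ 1# + δ (part ss j) (part ss i)
    distance-entry i j with part ss j Fin.≟ part ss i | i Fin.≟ j
    ... | yes _  | yes _   = trans (+-identityˡ _) (trans (*-identityʳ _) (+-congˡ (+-identityʳ 1#)))
    ... | yes _  | no _    = trans (+-congˡ (zeroʳ _)) (trans (+-identityʳ _) (+-congˡ (+-identityʳ 1#)))
    ... | no j≁i | yes i≡j = contradiction (≡.cong (part ss) (≡.sym i≡j)) j≁i
    ... | no _   | no _    = trans (+-congˡ (zeroʳ _)) (+-identityʳ _)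

    distance-row : ∀ i → ∑[ j < listSum ss ] (ι (distance ss i j) ∙ v j) + ι 2 ∙ v i ≈
                         sum v + partSum (part ss i)
    distance-row i = begin
      ∑[ j < n ] (ι (distance ss i j) ∙ v j) + ι 2 ∙ v i
        -- Spreading 2 v_i over all vertices lets `distance-entry` be applied termwise.
        ≈⟨ +-congˡ (*-congˡ (∑-δ i v)) ⟨
      ∑[ j < n ] (ι (distance ss i j) ∙ v j) + ι 2 ∙ ∑[ j < n ] (δ i j ∙ v j)
        ≈⟨ +-congˡ (*-distribˡ-sum {n} (ι 2) (λ j → δ i j ∙ v j)) ⟩
      ∑[ j < n ] (ι (distance ss i j) ∙ v j) + ∑[ j < n ] (ι 2 ∙ (δ i j ∙ v j))
        ≈⟨ ∑-distrib-+ {n} (λ j → ι (distance ss i j) ∙ v j) (λ j → ι 2 ∙ (δ i j ∙ v j)) ⟨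
      ∑[ j < n ] (ι (distance ss i j) ∙ v j + ι 2 ∙ (δ i j ∙ v j))
        ≈⟨ sum-cong-≋ {n} entry ⟩
      ∑[ j < n ] (v j + δ (part ss j) (part ss i) ∙ v j)
        ≈⟨ ∑-distrib-+ {n} v (λ j → δ (part ss j) (part ss i) ∙ v j) ⟩
      sum v + partSum (part ss i) ∎
      where
      n = listSum ss
      entry : ∀ j → ι (distance ss i j) ∙ v j + ι 2 ∙ (δ i j ∙ v j) ≈
                    v j + δ (part ss j) (part ss i) ∙ v j
      entry j = begin
        ι (distance ss i j) ∙ v j + ι 2 ∙ (δ i j ∙ v j)
          ≈⟨ solve 4 (λ d t e w → d :* w :+ t :* (e :* w) := (d :+ t :* e) :* w) ≈-refl
               (ι (distance ss i j)) (ι 2) (δ i j) (v j) ⟩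
        (ι (distance ss i j) + ι 2 ∙ δ i j) ∙ v j ≈⟨ *-congʳ (distance-entry i j) ⟩
        (1# + δ (part ss j) (part ss i)) ∙ v j
          ≈⟨ trans (distribʳ _ _ _) (+-congʳ (*-identityˡ (v j))) ⟩
        v j + δ (part ss j) (part ss i) ∙ v j ∎

    -- The vertex equations are summed over part `d`. Their right-hand sides depend on a vertex only
    -- through its part, so `∑-part` passes to a sum over parts, where the indicator leaves `d`
    -- alone, weighted by its size.
    partSum-eigen : ∀ y → (∀ i → y ∙ v i ≈ sum v + partSum (part ss i)) →
                    ∀ d → y ∙ partSum d ≈ ι (List.lookup ss d) ∙ (sum v + partSum d)
    partSum-eigen y eigen d = begin
      y ∙ partSum d
        ≈⟨ *-distribˡ-sum {listSum ss} y (λ j → δ (part ss j) d ∙ v j) ⟩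
      ∑[ j < listSum ss ] (y ∙ (δ (part ss j) d ∙ v j))
        ≈⟨ sum-cong-≋ {listSum ss} (λ j → trans
             (solve 3 (λ y e w → y :* (e :* w) := e :* (y :* w)) ≈-refl y (δ (part ss j) d) (v j))
             (*-congˡ (eigen j))) ⟩
      ∑[ j < listSum ss ] (δ (part ss j) d ∙ (sum v + partSum (part ss j)))
        ≈⟨ ∑-part ss (λ e → δ e d ∙ (sum v + partSum e)) ⟩
      ∑[ e < List.length ss ] (ι (List.lookup ss e) ∙ (δ e d ∙ (sum v + partSum e)))
        ≈⟨ sum-cong-≋ {List.length ss} (λ e → trans
             (solve 3 (λ s e t → s :* (e :* t) := e :* (s :* t)) ≈-refl
               (ι (List.lookup ss e)) (δ e d) (sum v + partSum e))
             (*-congʳ (reflexive (δ-sym e d)))) ⟩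
      ∑[ e < List.length ss ] (δ d e ∙ (ι (List.lookup ss e) ∙ (sum v + partSum e)))
        ≈⟨ ∑-δ d (λ e → ι (List.lookup ss e) ∙ (sum v + partSum e)) ⟩
      ι (List.lookup ss d) ∙ (sum v + partSum d) ∎

  -- Evaluation of polynomials

  module _ (u : Carrier) where

    ⟦_⟧ₚ : Poly → Carrier
    ⟦ [] ⟧ₚ    = 0#
    ⟦ n ∷ f ⟧ₚ = ι n + u ∙ ⟦ f ⟧ₚ

    ⊞-homo : ∀ f g → ⟦ f ⊞ g ⟧ₚ ≈ ⟦ f ⟧ₚ + ⟦ g ⟧ₚ
    ⊞-homo []      g       = sym (+-identityˡ ⟦ g ⟧ₚ)
    ⊞-homo (m ∷ f) []      = sym (+-identityʳ ⟦ m ∷ f ⟧ₚ)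
    ⊞-homo (m ∷ f) (n ∷ g) = begin
      ι (m ℕ.+ n) + u ∙ ⟦ f ⊞ g ⟧ₚ
        ≈⟨ +-cong (ι-+ m n) (*-congˡ (⊞-homo f g)) ⟩
      ι m + ι n + u ∙ (⟦ f ⟧ₚ + ⟦ g ⟧ₚ)
        ≈⟨ solve 5 (λ m n u f g → m :+ n :+ u :* (f :+ g) := m :+ u :* f :+ (n :+ u :* g)) ≈-refl
             (ι m) (ι n) u ⟦ f ⟧ₚ ⟦ g ⟧ₚ ⟩
      ⟦ m ∷ f ⟧ₚ + ⟦ n ∷ g ⟧ₚ ∎

    scale-homo : ∀ n f → ⟦ scale n f ⟧ₚ ≈ ι n ∙ ⟦ f ⟧ₚ
    scale-homo n []      = sym (zeroʳ (ι n))
    scale-homo n (m ∷ f) = begin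
      ι (n * m) + u ∙ ⟦ scale n f ⟧ₚ ≈⟨ +-cong (×1-homo-* n m) (*-congˡ (scale-homo n f)) ⟩
      ι n ∙ ι m + u ∙ (ι n ∙ ⟦ f ⟧ₚ)
        ≈⟨ solve 4 (λ n m u f → n :* m :+ u :* (n :* f) := n :* (m :+ u :* f)) ≈-refl
             (ι n) (ι m) u ⟦ f ⟧ₚ ⟩
      ι n ∙ ⟦ m ∷ f ⟧ₚ ∎

    X+⊠-homo : ∀ n f → ⟦ X+ n ⊠ f ⟧ₚ ≈ (u + ι n) ∙ ⟦ f ⟧ₚ
    X+⊠-homo n f = begin
      ⟦ (0 ∷ f) ⊞ scale n f ⟧ₚ
        ≈⟨ trans (⊞-homo (0 ∷ f) (scale n f)) (+-cong (+-identityˡ (u ∙ ⟦ f ⟧ₚ)) (scale-homo n f)) ⟩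
      u ∙ ⟦ f ⟧ₚ + ι n ∙ ⟦ f ⟧ₚ ≈⟨ distribʳ ⟦ f ⟧ₚ u (ι n) ⟨
      (u + ι n) ∙ ⟦ f ⟧ₚ ∎

    ∏X+-++ : ∀ {k l} (ms : Vec ℕ k) (ns : Vec ℕ l) →
             ⟦ ∏X+ (ms Vec.++ ns) ⟧ₚ ≈ ⟦ ∏X+ ms ⟧ₚ ∙ ⟦ ∏X+ ns ⟧ₚ
    ∏X+-++ []       ns =
      -- The constant polynomial `1 ∷ []` evaluates to `ι 1 + u ∙ 0#`, and `ι 1` unfolds to
      -- `1# + 0#`.
      solve 2 (λ u f → f := (con 1 :+ con 0 :+ u :* con 0) :* f) ≈-refl u ⟦ ∏X+ ns ⟧ₚ
    ∏X+-++ (m ∷ ms) ns = begin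
      ⟦ X+ m ⊠ ∏X+ (ms Vec.++ ns) ⟧ₚ
        ≈⟨ trans (X+⊠-homo m (∏X+ (ms Vec.++ ns))) (*-congˡ (∏X+-++ ms ns)) ⟩
      (u + ι m) ∙ (⟦ ∏X+ ms ⟧ₚ ∙ ⟦ ∏X+ ns ⟧ₚ) ≈⟨ *-assoc (u + ι m) ⟦ ∏X+ ms ⟧ₚ ⟦ ∏X+ ns ⟧ₚ ⟨
      (u + ι m) ∙ ⟦ ∏X+ ms ⟧ₚ ∙ ⟦ ∏X+ ns ⟧ₚ   ≈⟨ *-congʳ (X+⊠-homo m (∏X+ ms)) ⟨
      ⟦ ∏X+ (m ∷ ms) ⟧ₚ ∙ ⟦ ∏X+ ns ⟧ₚ ∎

    residual-∷ : ∀ {k} n (a : Vec ℕ k) x p →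
                 ⟦ residual (n ∷ a) (x ∷ p) ⟧ₚ ≈
                 ι n ∙ ι x ∙ ⟦ ∏X+ p ⟧ₚ + (u + ι x) ∙ ⟦ residual a p ⟧ₚ
    residual-∷ n a x p = trans (⊞-homo (scale (n * x) (∏X+ p)) (X+ x ⊠ residual a p)) (+-cong
      (trans (scale-homo (n * x) (∏X+ p)) (*-congʳ (×1-homo-* n x)))
      (X+⊠-homo x (residual a p)))

    -- The extra summand is the contribution of one more part of unscaled size `x`; this drives the
    -- induction on the first multiplicity.
    residual-suc : ∀ {k} n (a : Vec ℕ k) x p →
                   ⟦ residual (suc n ∷ a) (x ∷ p) ⟧ₚ ≈
                   ⟦ ∏X+ p ⟧ₚ ∙ ι x + ⟦ residual (n ∷ a) (x ∷ p) ⟧ₚ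
    residual-suc n a x p = begin
      ⟦ residual (suc n ∷ a) (x ∷ p) ⟧ₚ ≈⟨ residual-∷ (suc n) a x p ⟩
      (1# + ι n) ∙ ι x ∙ ⟦ ∏X+ p ⟧ₚ + (u + ι x) ∙ ⟦ residual a p ⟧ₚ
        ≈⟨ solve 4 (λ n x f w → (con 1 :+ n) :* x :* f :+ w := f :* x :+ (n :* x :* f :+ w)) ≈-refl
             (ι n) (ι x) ⟦ ∏X+ p ⟧ₚ ((u + ι x) ∙ ⟦ residual a p ⟧ₚ) ⟩
      ⟦ ∏X+ p ⟧ₚ ∙ ι x + (ι n ∙ ι x ∙ ⟦ ∏X+ p ⟧ₚ + (u + ι x) ∙ ⟦ residual a p ⟧ₚ)
        ≈⟨ +-congˡ (residual-∷ n a x p) ⟨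
      ⟦ ∏X+ p ⟧ₚ ∙ ι x + ⟦ residual (n ∷ a) (x ∷ p) ⟧ₚ ∎

    -- Part sums with denominators cleared

    module _ (q : ℕ) (r : Carrier) where

      -- The unscaled size `s` enters through an equation on the scaled size, so that dropping the
      -- first part is just `eqs ∘ suc`.
      PartEquations : ∀ {k} (a p : Vec ℕ k) →
                      (Fin (List.length (parts a (Vec.map (_* q) p))) → Carrier) → Set ℓ
      PartEquations a p T = ∀ d s → List.lookup (parts a (Vec.map (_* q) p)) d ≡ s * q →
                            (u + ι s) ∙ T d ≈ ι s ∙ r

      X+-part : ∀ {k} x (p : Vec ℕ k) {t z w} → ⟦ ∏X+ p ⟧ₚ ∙ t ≈ z → (u + ι x) ∙ z ≈ w →
                ⟦ ∏X+ (x ∷ p) ⟧ₚ ∙ t ≈ w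
      X+-part x p {t} eq₁ eq₂ =
        trans (*-congʳ (X+⊠-homo x (∏X+ p)))
          (trans (*-assoc (u + ι x) ⟦ ∏X+ p ⟧ₚ t) (trans (*-congˡ eq₁) eq₂))

      -- Clears the denominator in T = x r / (u + x) without assuming that u + x is invertible.
      first-part : ∀ {k} x (p : Vec ℕ k) {t} → (u + ι x) ∙ t ≈ ι x ∙ r →
                   ⟦ ∏X+ (x ∷ p) ⟧ₚ ∙ t ≈ ⟦ ∏X+ p ⟧ₚ ∙ ι x ∙ r
      first-part x p {t} eq = X+-part x p ≈-refl (begin
        (u + ι x) ∙ (⟦ ∏X+ p ⟧ₚ ∙ t)
          ≈⟨ solve 3 (λ s f t → s :* (f :* t) := f :* (s :* t)) ≈-refl (u + ι x) ⟦ ∏X+ p ⟧ₚ t ⟩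
        ⟦ ∏X+ p ⟧ₚ ∙ ((u + ι x) ∙ t) ≈⟨ *-congˡ eq ⟩
        ⟦ ∏X+ p ⟧ₚ ∙ (ι x ∙ r)       ≈⟨ *-assoc ⟦ ∏X+ p ⟧ₚ (ι x) r ⟨
        ⟦ ∏X+ p ⟧ₚ ∙ ι x ∙ r         ∎)

      -- Whatever annihilates `r` thereby annihilates each cleared part sum.
      part-multiple : ∀ {k} (a p : Vec ℕ k) T → PartEquations a p T →
                      ∀ d → ∃[ z ] ⟦ ∏X+ p ⟧ₚ ∙ T d ≈ z ∙ r
      part-multiple []         []      T eqs ()
      part-multiple (zero ∷ a) (x ∷ p) T eqs d with z , eq ← part-multiple a p T eqs d =
        -- A size of multiplicity zero yields no part, yet its factor occurs in the product and is
        -- absorbed into the multiplier.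
        (u + ι x) ∙ z , X+-part x p eq (sym (*-assoc (u + ι x) z r))
      part-multiple (suc n ∷ a) (x ∷ p) T eqs zero =
        ⟦ ∏X+ p ⟧ₚ ∙ ι x , first-part x p (eqs zero x refl)
      part-multiple (suc n ∷ a) (x ∷ p) T eqs (suc d) =
        part-multiple (n ∷ a) (x ∷ p) (T ∘ suc) (eqs ∘ suc) d

      -- The fractions s r / (u + s) are added up over a common denominator: `first-part` handles
      -- one part, and `residual-suc` matches it with one summand of the residual.
      parts-residual : ∀ {k} (a p : Vec ℕ k) T → PartEquations a p T →
                       ⟦ ∏X+ p ⟧ₚ ∙ sum T ≈ ⟦ residual a p ⟧ₚ ∙ r
      parts-residual [] [] T eqs = trans (zeroʳ _) (sym (zeroˡ r))
      parts-residual (zero ∷ a) (x ∷ p) T eqs = X+-part x p (parts-residual a p T eqs) (begin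
        (u + ι x) ∙ (⟦ residual a p ⟧ₚ ∙ r)
          -- The inserted zero term is the leading summand of `residual` at multiplicity zero.
          ≈⟨ solve 5 (λ s w x f r → s :* (w :* r) := (con 0 :* x :* f :+ s :* w) :* r) ≈-refl
               (u + ι x) ⟦ residual a p ⟧ₚ (ι x) ⟦ ∏X+ p ⟧ₚ r ⟩
        (ι 0 ∙ ι x ∙ ⟦ ∏X+ p ⟧ₚ + (u + ι x) ∙ ⟦ residual a p ⟧ₚ) ∙ r
          ≈⟨ *-congʳ (residual-∷ 0 a x p) ⟨
        ⟦ residual (zero ∷ a) (x ∷ p) ⟧ₚ ∙ r ∎)
      parts-residual (suc n ∷ a) (x ∷ p) T eqs = begin
        ⟦ ∏X+ (x ∷ p) ⟧ₚ ∙ (T zero + sum (T ∘ suc))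
          ≈⟨ distribˡ ⟦ ∏X+ (x ∷ p) ⟧ₚ (T zero) (sum (T ∘ suc)) ⟩
        ⟦ ∏X+ (x ∷ p) ⟧ₚ ∙ T zero + ⟦ ∏X+ (x ∷ p) ⟧ₚ ∙ sum (T ∘ suc)
          ≈⟨ +-cong (first-part x p (eqs zero x refl))
                    (parts-residual (n ∷ a) (x ∷ p) (T ∘ suc) (eqs ∘ suc)) ⟩
        ⟦ ∏X+ p ⟧ₚ ∙ ι x ∙ r + ⟦ residual (n ∷ a) (x ∷ p) ⟧ₚ ∙ r
          ≈⟨ distribʳ r (⟦ ∏X+ p ⟧ₚ ∙ ι x) ⟦ residual (n ∷ a) (x ∷ p) ⟧ₚ ⟨
        (⟦ ∏X+ p ⟧ₚ ∙ ι x + ⟦ residual (n ∷ a) (x ∷ p) ⟧ₚ) ∙ r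
          ≈⟨ *-congʳ (residual-suc n a x p) ⟨
        ⟦ residual (suc n ∷ a) (x ∷ p) ⟧ₚ ∙ r ∎

-- Heyting fields of characteristic zero

module _ {c ℓ₁ ℓ₂} (K : HeytingField c ℓ₁ ℓ₂) (char0 : CharacteristicZero K) where

  open HeytingField K hiding (zero) renaming (_*_ to infixl 7 _∙_; refl to ≈-refl)
  open HeytingCommutativeRing heytingCommutativeRing using (commutativeRing)
  open CommutativeRing commutativeRing
    using (semiring; ring; +-group; +-abelianGroup; commutativeSemiring)
  open import Algebra.Apartness.Properties.HeytingCommutativeRing heytingCommutativeRing
    using (x-0≈x; #-congʳ; invertibleˡ⇒#)
  open import Algebra.Properties.AbelianGroup +-abelianGroup using (xyx⁻¹≈y)
  open import Algebra.Properties.Group +-group using (inverseˡ-unique; ∙-cancelˡ)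
  open import Algebra.Properties.Ring ring using (-‿distribˡ-*; -‿distribʳ-*; -0#≈0#)
  open import Algebra.Properties.Semiring.Mult semiring using (×1-homo-*)
  open import Algebra.Properties.Semiring.Sum semiring using (sum)
  open import Algebra.Solver.Ring.NaturalCoefficients.Default commutativeSemiring
    using (solve; _:=_; _:+_; _:*_; con)
  open import Relation.Binary.Reasoning.Setoid setoid

  open RingIdentities commutativeRing

  *-cancelˡ-# : ∀ x {y z} → x # 0# → x ∙ y ≈ x ∙ z → y ≈ z
  *-cancelˡ-# x {y} {z} x#0 xy≈xz with x⁻¹ , x⁻¹x≈1 , _ ← #⇒invertible x#0 =
    trans (sym (undo y)) (trans (*-congˡ xy≈xz) (undo z))
    where
    undo : ∀ w → x⁻¹ ∙ (x ∙ w) ≈ w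
    undo w = begin
      x⁻¹ ∙ (x ∙ w)      ≈⟨ *-assoc _ _ _ ⟨
      -- The inverse is supplied for the difference `x - 0#`, not for `x` itself.
      x⁻¹ ∙ x ∙ w        ≈⟨ *-congʳ (*-congˡ (x-0≈x x)) ⟨
      x⁻¹ ∙ (x - 0#) ∙ w ≈⟨ *-congʳ x⁻¹x≈1 ⟩
      1# ∙ w             ≈⟨ *-identityˡ w ⟩
      w                  ∎

  x∙y≈0⇒y≈0 : ∀ {x y} → x # 0# → x ∙ y ≈ 0# → y ≈ 0#
  x∙y≈0⇒y≈0 x#0 xy≈0 = *-cancelˡ-# _ x#0 (trans xy≈0 (sym (zeroʳ _)))

  -- The two sides differ by the invertible element `y`, and elements with invertible difference are
  -- apart.
  x+y#x : ∀ x {y} → y # 0# → x + y # x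
  x+y#x x {y} y#0 with y⁻¹ , y⁻¹y≈1 , _ ← #⇒invertible y#0 =
    invertibleˡ⇒# (y⁻¹ , trans (*-congˡ (trans (xyx⁻¹≈y x y) (sym (x-0≈x y)))) y⁻¹y≈1)

  shift-#-< : ∀ u {m n} → m < n → u + ι n # u + ι m
  shift-#-< u {m} {n} m<n with k , refl ← ℕ.m≤n⇒∃[o]m+o≡n m<n =
    #-congʳ eq (x+y#x (u + ι m) (char0 k))
    where
    eq : u + ι m + ι (suc k) ≈ u + ι (suc m ℕ.+ k)
    eq = begin
      u + ι m + ι (suc k)   ≈⟨ +-assoc _ _ _ ⟩
      u + (ι m + ι (suc k)) ≈⟨ +-congˡ (ι-+ m (suc k)) ⟨
      u + ι (m ℕ.+ suc k)   ≡⟨ ≡.cong (λ n → u + ι n) (ℕ.+-suc m k) ⟩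
      u + ι (suc m ℕ.+ k)   ∎

  -- The two shifts differ by a nonzero integer, hence are apart in characteristic zero;
  -- cotransitivity compares both with `0#`.
  shift-# : ∀ u {m n} → m ≢ n → u + ι m # 0# ⊎ u + ι n # 0#
  shift-# u {m} {n} m≢n with ℕ.<-cmp m n
  ... | tri< m<n _ _ = [ inj₂ , inj₁ ∘ #-sym ]′ (#-cotrans (shift-#-< u m<n) 0#)
  ... | tri≈ _ m≡n _ = contradiction m≡n m≢n
  ... | tri> _ _ n<m = [ inj₁ , inj₂ ∘ #-sym ]′ (#-cotrans (shift-#-< u n<m) 0#)

  -- By `shift-#` one of the first two factors is apart from zero. Cancelling it leaves a shorter
  -- vanishing product with distinct shifts, until a single factor remains.
  ∏X+-root : ∀ {k} u n (ns : Vec ℕ k) → Unique (n ∷ ns) → ⟦_⟧ₚ u (∏X+ (n ∷ ns)) ≈ 0# →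
             ∃[ m ] u + ι m ≈ 0#
  ∏X+-root u n [] _ eq = n , (begin
    u + ι n ≈⟨ solve 2 (λ u n → u :+ n := (u :+ n) :* (con 1 :+ con 0 :+ u :* con 0)) ≈-refl u (ι n) ⟩
    (u + ι n) ∙ (ι 1 + u ∙ 0#) ≈⟨ X+⊠-homo u n (∏X+ []) ⟨
    ⟦_⟧ₚ u (∏X+ (n ∷ []))      ≈⟨ eq ⟩
    0# ∎)
  ∏X+-root u n (m ∷ ns) ((n≢m ∷ n∉ns) ∷ m∉ns ∷ !ns) eq with shift-# u n≢m
  ... | inj₁ u+n#0 = ∏X+-root u m ns (m∉ns ∷ !ns)
                       (x∙y≈0⇒y≈0 u+n#0 (trans (sym (X+⊠-homo u n (∏X+ (m ∷ ns)))) eq))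
  ... | inj₂ u+m#0 = ∏X+-root u n ns (n∉ns ∷ !ns) (x∙y≈0⇒y≈0 u+m#0 (begin
    (u + ι m) ∙ ⟦_⟧ₚ u (∏X+ (n ∷ ns))              ≈⟨ *-congˡ (X+⊠-homo u n (∏X+ ns)) ⟩
    (u + ι m) ∙ ((u + ι n) ∙ ⟦_⟧ₚ u (∏X+ ns))
      ≈⟨ solve 3 (λ s t f → s :* (t :* f) := t :* (s :* f)) ≈-refl (u + ι m) (u + ι n) (⟦_⟧ₚ u (∏X+ ns)) ⟩
    (u + ι n) ∙ ((u + ι m) ∙ ⟦_⟧ₚ u (∏X+ ns))      ≈⟨ *-congˡ (X+⊠-homo u m (∏X+ ns)) ⟨
    (u + ι n) ∙ ⟦_⟧ₚ u (∏X+ (m ∷ ns))              ≈⟨ X+⊠-homo u n (∏X+ (m ∷ ns)) ⟨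
    ⟦_⟧ₚ u (∏X+ (n ∷ m ∷ ns))                      ≈⟨ eq ⟩
    0# ∎))

  -- Units are cancelled on both sides until `k` or `n` is exhausted; what is left is n - k already
  -- in constructor form, on which `fromℤ` computes.
  natural-difference : ∀ x k n → x + ι k ≈ ι n → ∃[ z ] x ≈ fromℤ K z
  natural-difference x zero    n       eq = + n , trans (sym (+-identityʳ x)) eq
  natural-difference x (suc k) zero    eq = -[1+ k ] , inverseˡ-unique x (ι (suc k)) eq
  natural-difference x (suc k) (suc n) eq = natural-difference x k n (∙-cancelˡ 1# (x + ι k) (ι n)
    (trans (solve 2 (λ x k → con 1 :+ (x :+ k) := x :+ (con 1 :+ k)) ≈-refl x (ι k)) eq))

  negated-quotient : ∀ y q → ∃[ u ] y + u ∙ ι (suc q) ≈ 0#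
  negated-quotient y q with Q⁻¹ , Q⁻¹Q≈1 , _ ← #⇒invertible (char0 q) = - (y ∙ Q⁻¹) , (begin
    y + - (y ∙ Q⁻¹) ∙ Q      ≈⟨ +-congˡ (-‿distribˡ-* (y ∙ Q⁻¹) Q) ⟨
    y - y ∙ Q⁻¹ ∙ Q          ≈⟨ +-congˡ (-‿cong (*-assoc y Q⁻¹ Q)) ⟩
    y - y ∙ (Q⁻¹ ∙ Q)        ≈⟨ +-congˡ (-‿cong (*-congˡ (*-congˡ (x-0≈x Q)))) ⟨
    y - y ∙ (Q⁻¹ ∙ (Q - 0#)) ≈⟨ +-congˡ (-‿cong (*-congˡ Q⁻¹Q≈1)) ⟩
    y - y ∙ 1#               ≈⟨ +-congˡ (-‿cong (*-identityʳ y)) ⟩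
    y - y                    ≈⟨ -‿inverseʳ y ⟩
    0#                       ∎)
    where
    Q : Carrier
    Q = ι (suc q)

  -- Adding (u + n) q = 0 to `y` replaces u q by n q, without any subtraction.
  negated-root : ∀ {y u q} n → y + u ∙ ι q ≈ 0# → u + ι n ≈ 0# → y ≈ ι (n * q)
  negated-root {y} {u} {q} n y+uq≈0 u+n≈0 = begin
    y                         ≈⟨ +-identityʳ y ⟨
    y + 0#                    ≈⟨ +-congˡ (trans (*-congʳ u+n≈0) (zeroˡ (ι q))) ⟨
    y + (u + ι n) ∙ ι q
      ≈⟨ solve 4 (λ y u n q → y :+ (u :+ n) :* q := y :+ u :* q :+ n :* q) ≈-refl y u (ι n) (ι q) ⟩
    y + u ∙ ι q + ι n ∙ ι q   ≈⟨ +-cong y+uq≈0 (sym (×1-homo-* n q)) ⟩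
    0# + ι (n * q)            ≈⟨ +-identityˡ (ι (n * q)) ⟩
    ι (n * q)                 ∎

  -- Annihilation of eigenvector entries, with `m` in the role of the shifted μ + 2

  module _ {k l} (q : ℕ) (a p : Vec ℕ k) (m : Vec ℕ l)
           (identity : ∏X+ p ⊞ residual a p ≡ ∏X+ m) where

    ss : List ℕ
    ss = parts a (Vec.map (_* suc q) p)

    module _ {u y} (y+uq≈0 : y + u ∙ ι (suc q) ≈ 0#) (v : Fin (listSum ss) → Carrier)
             (eigen : ∀ i → y ∙ v i ≈ sum v + partSum ss v (part ss i)) where

      private
        Q S r P N M : Carrier
        Q = ι (suc q)
        S = sum v
        r = - S
        P = ⟦_⟧ₚ u (∏X+ p)
        N = ⟦_⟧ₚ u (residual a p)
        M = ⟦_⟧ₚ u (∏X+ m)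

        T : Fin (List.length ss) → Carrier
        T = partSum ss v

      -- This is `partSum-eigen` with y = - u Q and sizes s Q: the common factor `Q` cancels because
      -- it is apart from zero.
      part-equations : PartEquations u (suc q) r a p T
      part-equations d s size = *-cancelˡ-# Q (char0 q) (begin
        Q ∙ ((u + ι s) ∙ T d)
          ≈⟨ +-identityʳ _ ⟨
        Q ∙ ((u + ι s) ∙ T d) + 0#
          -- Adding s Q (S + r) = 0 brings in `S` while treating `r` as an opaque element, so the
          -- rearrangement is a semiring identity.
          ≈⟨ +-congˡ (trans (*-congˡ (-‿inverseʳ S)) (zeroʳ _)) ⟨
        Q ∙ ((u + ι s) ∙ T d) + ι s ∙ Q ∙ (S + r)
          ≈⟨ solve 6 (λ Q u s T S r → Q :* ((u :+ s) :* T) :+ s :* Q :* (S :+ r) :=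
                                      s :* Q :* (S :+ T) :+ (u :* Q :* T :+ Q :* (s :* r)))
               ≈-refl Q u (ι s) (T d) S r ⟩
        ι s ∙ Q ∙ (S + T d) + (u ∙ Q ∙ T d + Q ∙ (ι s ∙ r))
          ≈⟨ +-congʳ (*-congʳ (×1-homo-* s (suc q))) ⟨
        ι (s * suc q) ∙ (S + T d) + (u ∙ Q ∙ T d + Q ∙ (ι s ∙ r))
          ≡⟨ ≡.cong (λ n → ι n ∙ (S + T d) + (u ∙ Q ∙ T d + Q ∙ (ι s ∙ r))) size ⟨
        ι (List.lookup ss d) ∙ (S + T d) + (u ∙ Q ∙ T d + Q ∙ (ι s ∙ r))
          ≈⟨ +-congʳ (partSum-eigen ss v y eigen d) ⟨
        y ∙ T d + (u ∙ Q ∙ T d + Q ∙ (ι s ∙ r))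
          ≈⟨ solve 4 (λ y uQ T z → y :* T :+ (uQ :* T :+ z) := (y :+ uQ) :* T :+ z)
               ≈-refl y (u ∙ Q) (T d) (Q ∙ (ι s ∙ r)) ⟩
        (y + u ∙ Q) ∙ T d + Q ∙ (ι s ∙ r)
          ≈⟨ +-congʳ (trans (*-congʳ y+uq≈0) (zeroˡ _)) ⟩
        0# + Q ∙ (ι s ∙ r)
          ≈⟨ +-identityˡ _ ⟩
        Q ∙ (ι s ∙ r) ∎)

      -- `identity` splits `M` as P + N, and P S = N r = - N S because the part sums add up to `S`.
      sum-annihilated : M ∙ S ≈ 0#
      sum-annihilated = begin
        M ∙ S                              ≡⟨ ≡.cong (λ f → ⟦_⟧ₚ u f ∙ S) identity ⟨
        ⟦_⟧ₚ u (∏X+ p ⊞ residual a p) ∙ S  ≈⟨ *-congʳ (⊞-homo u (∏X+ p) (residual a p)) ⟩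
        (P + N) ∙ S                        ≈⟨ distribʳ _ _ _ ⟩
        P ∙ S + N ∙ S                      ≈⟨ +-congʳ (*-congˡ (∑-partSum ss v)) ⟨
        P ∙ sum T + N ∙ S
          ≈⟨ +-congʳ (parts-residual u (suc q) r a p T part-equations) ⟩
        N ∙ r + N ∙ S                      ≈⟨ distribˡ _ _ _ ⟨
        N ∙ (r + S)                        ≈⟨ *-congˡ (-‿inverseˡ S) ⟩
        N ∙ 0#                             ≈⟨ zeroʳ N ⟩
        0#                                 ∎

      partSum-annihilated : ∀ d → M ∙ (P ∙ T d) ≈ 0#
      partSum-annihilated d = let z , eq = part-multiple u (suc q) r a p T part-equations d in begin
        M ∙ (P ∙ T d)   ≈⟨ *-congˡ eq ⟩
        M ∙ (z ∙ r)     ≈⟨ solve 3 (λ M z r → M :* (z :* r) := z :* (M :* r)) ≈-refl M z r ⟩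
        z ∙ (M ∙ r)     ≈⟨ *-congˡ (-‿distribʳ-* M S) ⟨
        z ∙ - (M ∙ S)   ≈⟨ *-congˡ (trans (-‿cong sum-annihilated) -0#≈0#) ⟩
        z ∙ 0#          ≈⟨ zeroʳ z ⟩
        0#              ∎

      -- Since P M kills both `S` and the part sum, it kills y v_i, which equals - u Q v_i;
      -- cancelling `Q` leaves the factor `u`, listed as the shift 0.
      entry-annihilated : ∀ i → ⟦_⟧ₚ u (∏X+ (0 ∷ p Vec.++ m)) ∙ v i ≈ 0#
      entry-annihilated i = x∙y≈0⇒y≈0 (char0 q) (begin
        Q ∙ (⟦_⟧ₚ u (∏X+ (0 ∷ p Vec.++ m)) ∙ v i)
          ≈⟨ *-congˡ (*-congʳ (trans (X+⊠-homo u 0 (∏X+ (p Vec.++ m))) (*-congˡ (∏X+-++ u p m)))) ⟩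
        Q ∙ ((u + 0#) ∙ (P ∙ M) ∙ v i)
          ≈⟨ +-identityʳ _ ⟨
        Q ∙ ((u + 0#) ∙ (P ∙ M) ∙ v i) + 0#
          -- The added zero is P M (S + T), which the vertex equation turns into P M y v_i.
          ≈⟨ +-congˡ (trans (+-cong (trans (*-congˡ sum-annihilated) (zeroʳ P))
                                    (partSum-annihilated (part ss i))) (+-identityʳ 0#)) ⟨
        Q ∙ ((u + 0#) ∙ (P ∙ M) ∙ v i) + (P ∙ (M ∙ S) + M ∙ (P ∙ T (part ss i)))
          ≈⟨ solve 7 (λ Q u P M w S T →
               Q :* ((u :+ con 0) :* (P :* M) :* w) :+ (P :* (M :* S) :+ M :* (P :* T)) :=
               P :* M :* (u :* Q :* w) :+ P :* M :* (S :+ T))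
               ≈-refl Q u P M (v i) S (T (part ss i)) ⟩
        P ∙ M ∙ (u ∙ Q ∙ v i) + P ∙ M ∙ (S + T (part ss i))
          ≈⟨ +-congˡ (*-congˡ (eigen i)) ⟨
        P ∙ M ∙ (u ∙ Q ∙ v i) + P ∙ M ∙ (y ∙ v i)
          ≈⟨ solve 4 (λ PM uQ y w → PM :* (uQ :* w) :+ PM :* (y :* w) := PM :* w :* (y :+ uQ))
               ≈-refl (P ∙ M) (u ∙ Q) y (v i) ⟩
        P ∙ M ∙ v i ∙ (y + u ∙ Q)
          ≈⟨ trans (*-congˡ y+uq≈0) (zeroʳ _) ⟩
        0# ∎)

    -- At an entry apart from zero, `entry-annihilated` makes the polynomial itself vanish at `u`.
    -- So u = - n for some natural `n`, and x = n (q + 1) - 2.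
    eigenvalue-integer : Unique (0 ∷ p Vec.++ m) → ∀ x →
                         IsEigenvalue K (λ i j → + distance ss i j) x →
                         ∃[ z ] x ≈ fromℤ K z
    eigenvalue-integer !roots x (v , (i , vi#0) , eq) =
      -- The shift by 2 passes from D to D + 2I = J + B.
      let u , y+uq≈0 = negated-quotient (x + ι 2) q
          n , u+n≈0  = ∏X+-root u 0 (p Vec.++ m) !roots (x∙y≈0⇒y≈0 vi#0
                         (trans (*-comm (v i) _) (entry-annihilated y+uq≈0 v eigen i)))
      in natural-difference x 2 (n * suc q) (negated-root n y+uq≈0 u+n≈0)
      where
      eigen : ∀ i → (x + ι 2) ∙ v i ≈ sum v + partSum ss v (part ss i)
      eigen i = trans (distribʳ (v i) x (ι 2)) (trans (+-congʳ (sym (eq i))) (distance-row ss v i))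

-- The table

-- Decidable conditions on a tuple. After the stated arithmetic relations come two nonempty parts of
-- the first size, for connectedness; distinctness of all shifts, for `∏X+-root`; and the
-- multiplicity formula as an equality of coefficient lists.
Suitable : Parameters → Set
Suitable t@(tuple p a μ) =
  (Coprime t × Interlacing t × MultiplicityFormula t) ×
  (0 < Vec.head p × 1 < Vec.head a) ×
  Unique (0 ∷ p Vec.++ Vec.map (2 ℕ.+_) μ) ×
  ∏X+ p ⊞ residual a p ≡ ∏X+ (Vec.map (2 ℕ.+_) μ)

suitable? : ∀ t → Dec (Suitable t)
suitable? (tuple p a μ) =
  (_ ℕ.≟ _ ×-dec
   (Fin.all? (λ i → _ ℤ.<? _) ×-dec Fin.all? (λ i → _ ℤ.<? _)) ×-dec
   Fin.all? (λ k → ¬? (_ ℤ.≟ _) ×-dec _ ℤ.≟ _)) ×-dec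
  (_ ℕ.<? _ ×-dec _ ℕ.<? _) ×-dec
  allPairs? (λ m n → ¬? (m ℕ.≟ n)) _ ×-dec
  ≡-dec ℕ._≟_ _ _

-- The numerical content is checked here, by evaluating the decision procedure on every tuple.
table-suitable : All.All Suitable table
table-suitable = toWitness {a? = All.all? suitable? table} _

suitable-distanceIntegral : ∀ c ℓ₁ ℓ₂ t → Suitable t → ∀ q →
                            DistanceIntegral c ℓ₁ ℓ₂ (scaledGraph t (suc q))
suitable-distanceIntegral c ℓ₁ ℓ₂ (tuple p a μ) (_ , (p₁>0 , a₁>1) , !roots , identity) q =
  distance (parts a (Vec.map (_* suc q) p)) ,
  distance-isDistanceMatrix (parts a (Vec.map (_* suc q) p)) (parts-other q a p a₁>1 p₁>0) ,
  λ K char0 → eigenvalue-integer K char0 q a p (Vec.map (2 ℕ.+_) μ) identity !roots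

theorem6 : (c ℓ₁ ℓ₂ : Level) (t : Parameters) → t ∈ table →
    (Coprime t × Interlacing t × MultiplicityFormula t) ×
    (∀ (q : ℕ) → 0 < q →
    Graph.order (scaledGraph t q) ≡ q * numberOfVertices t ×
    DistanceIntegral c ℓ₁ ℓ₂ (scaledGraph t q))
theorem6 c ℓ₁ ℓ₂ t@(tuple p a μ) t∈table =
  Product.proj₁ suitable ,
  λ { zero    () ;
      (suc q) _ → sum-parts (suc q) a p , suitable-distanceIntegral c ℓ₁ ℓ₂ t suitable q }
  where
  suitable : Suitable t
  suitable = All.lookup table-suitable t∈table
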